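{- Let $C_{(\neq,>)}(x,y)$ be the bivariate generating function of the Catalan words avoiding the ordered pair of relations $(\neq,>)$, where $x$ marks the length and $y$ marks the number of descents. Then $$C_{(\neq,>)}(x,y)=\frac{1 - 2 x + 2 x^2 y - \sqrt{1 - 4 x + 4 x^2 - 4 x^3 y}}{2 x^2 y}.$$
   Context: A Catalan word of length $n$ is a word $w=w_1w_2\cdots w_n$ over the non-negative integers with $w_1=0$ and $0\leq w_i\leq w_{i-1}+1$ for $i=2,\dots,n$; the empty word is the unique Catalan word of length $0$. For relations $X,Y\in\{<,>,\leq,\geq,=,\neq\}$, a word $w$ contains the pattern $(X,Y)$ if there is an index $i\geq 1$ (with $i+2\le n$) such that $w_i\,X\,w_{i+1}$ and $w_{i+1}\,Y\,w_{i+2}$; otherwise $w$ avoids $(X,Y)$. The number of descents $\mathrm{des}(w)$ is the number of indices $i$ with $w_i>w_{i+1}$. The bivariate generating function is $C_{(X,Y)}(x,y)=\sum_{w}x^{|w|}y^{\mathrm{des}(w)}$, the sum being over all Catalan words $w$ (of any length $|w|\geq 0$) avoiding $(X,Y)$. Identities are between formal power series in $x$ with coefficients polynomials in $y$ (after clearing denominators); the square root of a power series with constant term $1$ is the one with constant term $1$. -}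

module Defs where

open import Data.Integer as ℤ using (ℤ; +_; 0ℤ; 1ℤ)
import Algebra.Properties.Group as GroupProperties
import Data.Integer.Properties as ℤₚ
open import Data.Integer.Tactic.RingSolver using (solve-∀)
open import Data.List using
  (List; []; _∷_; _++_; map; foldr; filter; replicate; length; head; upTo; cartesianProductWith)
open import Data.List.Membership.Propositional using (_∈_)
open import Data.List.Membership.Propositional.Properties using
  (∈-upTo⁺; ∈-cartesianProductWith⁺; ∈-cartesianProductWith⁻; ∈-filter⁺; ∈-filter⁻)
open import Data.List.Properties using (∷-injective)
open import Data.List.Relation.Unary.All using (All; []; _∷_)
open import Data.List.Relation.Unary.Any using (here)
open import Data.List.Relation.Unary.Linked using (Linked; []; [-]; _∷_; linked?)
open import Data.List.Relation.Unary.Unique.Propositional using (Unique)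
import Data.List.Relation.Unary.Unique.Propositional.Properties as Uniqueₚ
open import Data.List.Relation.Unary.AllPairs using ([]; _∷_)
open import Data.Maybe.Relation.Unary.All as Maybe using (just)
open import Data.Nat using (ℕ; zero; suc; _∸_; _≤_; _<_; _≤?_; _>?_; _≟_; z≤n; s≤s)
open import Data.Nat.Induction using (<-rec)
import Data.Nat.Properties as ℕₚ
open import Data.Product using (_×_; _,_; proj₁; proj₂)
open import Function using (_∘_; _⇔_; mk⇔)
open import Algebra.Bundles using (AbelianGroup)
open import Level using (0ℓ)
open import Relation.Binary using (Rel; Decidable)
open import Relation.Binary.PropositionalEquality using
  (_≡_; _≢_; refl; sym; trans; cong; cong₂; subst; module ≡-Reasoning)
open import Relation.Nullary using (¬_; Dec; yes; no)
open import Relation.Nullary.Decidable using (does; ¬?; _×-dec_; _⊎-dec_; map′)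
open import Data.Bool using (if_then_else_)
open import Data.Sum using (inj₁; inj₂)

Word : Set
Word = List ℕ

Catalan : Word → Set
Catalan w = Maybe.All (_≡ 0) (head w) × Linked (λ a b → b ≤ suc a) w

data Contains (X Y : Rel ℕ 0ℓ) : Word → Set where
  here  : ∀ {a b c w} → X a b → Y b c → Contains X Y (a ∷ b ∷ c ∷ w)
  there : ∀ {a w} → Contains X Y w → Contains X Y (a ∷ w)

Avoids : (X Y : Rel ℕ 0ℓ) → Word → Set
Avoids X Y w = ¬ Contains X Y w

des : Word → ℕ
des (a ∷ b ∷ w) = if does (a >? b) then suc (des (b ∷ w)) else des (b ∷ w)
des _           = 0

catalan? : ∀ w → Dec (Catalan w)
catalan? w = Maybe.dec (_≟ 0) (head w) ×-dec linked? (λ a b → b ≤? suc a) w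

_≢?_ : Decidable (_≢_ {A = ℕ})
a ≢? b = ¬? (a ≟ b)

module _ {X Y : Rel ℕ 0ℓ} (X? : Decidable X) (Y? : Decidable Y) where

  contains? : ∀ w → Dec (Contains X Y w)
  contains? []          = no λ ()
  contains? (_ ∷ [])    = no λ { (there ()) }
  contains? (_ ∷ _ ∷ []) = no λ { (there (there ())) }
  contains? (a ∷ b ∷ c ∷ w) =
    map′ (λ { (inj₁ (p , q)) → here p q ; (inj₂ r) → there r })
         (λ { (here p q) → inj₁ (p , q) ; (there r) → inj₂ r })
         ((X? a b ×-dec Y? b c) ⊎-dec contains? (b ∷ c ∷ w))

  avoids? : ∀ w → Dec (Avoids X Y w)
  avoids? w = ¬? (contains? w)

words : (m n : ℕ) → List Word
words m zero    = [] ∷ []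
words m (suc n) = cartesianProductWith _∷_ (upTo m) (words m n)

-- A Catalan word of length n only uses letters < n, so restricting the
-- alphabet to upTo n loses nothing; see ∈-avoiders.
avoiders : ∀ {X Y : Rel ℕ 0ℓ} → Decidable X → Decidable Y → ℕ → List Word
avoiders X? Y? n =
  filter (λ w → catalan? w ×-dec avoids? X? Y? w) (words n n)

-- Polynomials in y over ℤ, as lists of coefficients: lowest degree first,
-- trailing zeros allowed, hence compared by _≈ₚ_.
Poly : Set
Poly = List ℤ

coeff : Poly → ℕ → ℤ
coeff []      _       = 0ℤ
coeff (a ∷ p) zero    = a
coeff (a ∷ p) (suc k) = coeff p k

infix  4 _≈ₚ_
infixl 6 _+ₚ_
infixl 7 _*ₚ_

_≈ₚ_ : Rel Poly 0ℓ
p ≈ₚ q = ∀ k → coeff p k ≡ coeff q k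

_+ₚ_ : Poly → Poly → Poly
[]      +ₚ q       = q
(a ∷ p) +ₚ []      = a ∷ p
(a ∷ p) +ₚ (b ∷ q) = (a ℤ.+ b) ∷ (p +ₚ q)

-ₚ_ : Poly → Poly
-ₚ p = map (λ a → ℤ.- a) p

_*ₚ_ : Poly → Poly → Poly
[]      *ₚ q = []
(a ∷ p) *ₚ q = map (a ℤ.*_) q +ₚ (0ℤ ∷ (p *ₚ q))

y^_ : ℕ → Poly
y^ k = replicate k 0ℤ ++ (1ℤ ∷ [])

sumₚ : List Poly → Poly
sumₚ = foldr _+ₚ_ []

-- ℤ[y][[x]]: the coefficient of xⁿ is the value at n.
Series : Set
Series = ℕ → Poly

infix  4 _≈_
infixl 6 _+_ _-_
infixl 7 _*_
infixr 8 _^_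

_≈_ : Rel Series 0ℓ
f ≈ g = ∀ n → f n ≈ₚ g n

_+_ : Series → Series → Series
(f + g) n = f n +ₚ g n

_-_ : Series → Series → Series
(f - g) n = f n +ₚ (-ₚ g n)

-- Σ≤ n t  is  t 0 + t 1 + ⋯ + t n.
Σ≤ : ℕ → (ℕ → Poly) → Poly
Σ≤ zero    t = t 0
Σ≤ (suc n) t = t 0 +ₚ Σ≤ n (t ∘ suc)

_*_ : Series → Series → Series
(f * g) n = Σ≤ n (λ i → f i *ₚ g (n ∸ i))

const : Poly → Series
const p zero    = p
const p (suc _) = []

nat : ℕ → Series
nat m = const (+ m ∷ [])

x : Series
x 1 = 1ℤ ∷ []
x _ = []

y : Series
y = const (y^ 1)

_^_ : Series → ℕ → Series
f ^ zero  = nat 1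
f ^ suc k = f * f ^ k

-- The constant term in x must be the polynomial 1; by √-unique at most one
-- series S satisfies S Is√ f.
infix 4 _Is√_
_Is√_ : Series → Series → Set
S Is√ f = S 0 ≈ₚ (1ℤ ∷ []) × S * S ≈ f

-- The coefficient of xⁿ is the sum of y^des(w) over the words w of length n.
C : ∀ {X Y : Rel ℕ 0ℓ} → Decidable X → Decidable Y → Series
C X? Y? n = sumₚ (map (λ w → y^ des w) (avoiders X? Y? n))

-- ∈-avoiders and avoiders-unique: avoiders X? Y? n lists exactly the avoiding
-- Catalan words of length n, each once, so C sums over the right set.

∈-words⁺ : ∀ {m} w → All (_< m) w → w ∈ words m (length w)
∈-words⁺ []      []         = here refl
∈-words⁺ (a ∷ w) (a<m ∷ w<m) =
  ∈-cartesianProductWith⁺ _∷_ (∈-upTo⁺ a<m) (∈-words⁺ w w<m)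

∈-words⁻ : ∀ m n {w} → w ∈ words m n → length w ≡ n
∈-words⁻ m zero    (here refl) = refl
∈-words⁻ m (suc n) w∈ with ∈-cartesianProductWith⁻ _∷_ (upTo m) (words m n) w∈
... | _ , _ , _ , v∈ , refl = cong suc (∈-words⁻ m n v∈)

words-unique : ∀ m n → Unique (words m n)
words-unique m zero    = [] ∷ []
words-unique m (suc n) =
  Uniqueₚ.cartesianProductWith⁺ _∷_ ∷-injective (Uniqueₚ.upTo⁺ m) (words-unique m n)

linked-bound : ∀ {a w} b → a ≤ b → Linked (λ a b → b ≤ suc a) (a ∷ w) →
               All (_< suc (b Data.Nat.+ length w)) (a ∷ w)
linked-bound {w = []}    b a≤b [-]      = s≤s (ℕₚ.≤-trans a≤b (ℕₚ.m≤m+n b 0)) ∷ []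
linked-bound {w = c ∷ w} b a≤b (c≤ ∷ l) =
  s≤s (ℕₚ.≤-trans a≤b (ℕₚ.m≤m+n b _)) ∷
  subst (λ k → All (_< suc k) (c ∷ w)) (sym (ℕₚ.+-suc b (length w)))
        (linked-bound (suc b) (ℕₚ.≤-trans c≤ (s≤s a≤b)) l)

catalan-bound : ∀ w → Catalan w → All (_< length w) w
catalan-bound []      _               = []
catalan-bound (_ ∷ w) (just refl , l) = linked-bound 0 z≤n l

module _ {X Y : Rel ℕ 0ℓ} (X? : Decidable X) (Y? : Decidable Y) where

  private
    P? : ∀ w → Dec (Catalan w × Avoids X Y w)
    P? w = catalan? w ×-dec avoids? X? Y? w

  ∈-avoiders : ∀ n w →
    w ∈ avoiders X? Y? n ⇔ (length w ≡ n × Catalan w × Avoids X Y w)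
  ∈-avoiders n w = mk⇔ to from
    where
    to : w ∈ avoiders X? Y? n → length w ≡ n × Catalan w × Avoids X Y w
    to w∈ with ∈-filter⁻ P? {xs = words n n} w∈
    ... | w∈′ , cw , av = ∈-words⁻ n n w∈′ , cw , av

    from : length w ≡ n × Catalan w × Avoids X Y w → w ∈ avoiders X? Y? n
    from (refl , cw , av) =
      ∈-filter⁺ P? (∈-words⁺ w (catalan-bound w cw)) (cw , av)

  avoiders-unique : ∀ n → Unique (avoiders X? Y? n)
  avoiders-unique n = Uniqueₚ.filter⁺ P? (words-unique n n)

sumℤ : ℕ → (ℕ → ℤ) → ℤ
sumℤ zero    t = t 0
sumℤ (suc n) t = t 0 ℤ.+ sumℤ n (t ∘ suc)

sumℤ-cong : ∀ n {s t : ℕ → ℤ} → (∀ i → s i ≡ t i) → sumℤ n s ≡ sumℤ n t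
sumℤ-cong zero    e = e 0
sumℤ-cong (suc n) e = cong₂ ℤ._+_ (e 0) (sumℤ-cong n (e ∘ suc))

sumℤ-zero : ∀ n → sumℤ n (λ _ → 0ℤ) ≡ 0ℤ
sumℤ-zero zero    = refl
sumℤ-zero (suc n) = trans (ℤₚ.+-identityˡ _) (sumℤ-zero n)

coeff-+ : ∀ p q k → coeff (p +ₚ q) k ≡ coeff p k ℤ.+ coeff q k
coeff-+ []      q       k       = sym (ℤₚ.+-identityˡ _)
coeff-+ (a ∷ p) []      k       = sym (ℤₚ.+-identityʳ _)
coeff-+ (a ∷ p) (b ∷ q) zero    = refl
coeff-+ (a ∷ p) (b ∷ q) (suc k) = coeff-+ p q k

coeff-scale : ∀ a q k → coeff (map (a ℤ.*_) q) k ≡ a ℤ.* coeff q k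
coeff-scale a []      k       = sym (ℤₚ.*-zeroʳ a)
coeff-scale a (b ∷ q) zero    = refl
coeff-scale a (b ∷ q) (suc k) = coeff-scale a q k

coeff-* : ∀ p q k → coeff (p *ₚ q) k ≡ sumℤ k (λ i → coeff p i ℤ.* coeff q (k ∸ i))
coeff-* []      q k    = sym (trans (sumℤ-cong k λ i → ℤₚ.*-zeroˡ (coeff q (k ∸ i))) (sumℤ-zero k))
coeff-* (a ∷ p) q zero = trans (coeff-+ (map (a ℤ.*_) q) _ 0)
  (trans (ℤₚ.+-identityʳ _) (coeff-scale a q 0))
coeff-* (a ∷ p) q (suc k) = trans (coeff-+ (map (a ℤ.*_) q) _ (suc k))
  (cong₂ ℤ._+_ (coeff-scale a q (suc k)) (coeff-* p q k))

coeff-Σ : ∀ n t k → coeff (Σ≤ n t) k ≡ sumℤ n (λ i → coeff (t i) k)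
coeff-Σ zero    t k = refl
coeff-Σ (suc n) t k =
  trans (coeff-+ (t 0) _ k) (cong (λ z → coeff (t 0) k ℤ.+ z) (coeff-Σ n (t ∘ suc) k))

*ₚ-cong : ∀ {p p′ q q′} → p ≈ₚ p′ → q ≈ₚ q′ → p *ₚ q ≈ₚ p′ *ₚ q′
*ₚ-cong {p} {p′} {q} {q′} e e′ k = trans (coeff-* p q k)
  (trans (sumℤ-cong k λ i → cong₂ ℤ._*_ (e i) (e′ (k ∸ i))) (sym (coeff-* p′ q′ k)))

coeff-1* : ∀ {p} q k → p ≈ₚ (1ℤ ∷ []) → coeff (p *ₚ q) k ≡ coeff q k
coeff-1* {p} q k e = trans (*ₚ-cong {p} {1ℤ ∷ []} {q} {q} e (λ _ → refl) k)
  (trans (coeff-+ (map (1ℤ ℤ.*_) q) _ k)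
    (trans (cong₂ ℤ._+_ (trans (coeff-scale 1ℤ q k) (ℤₚ.*-identityˡ _)) (shift k))
           (ℤₚ.+-identityʳ _)))
  where
  shift : ∀ k → coeff (0ℤ ∷ []) k ≡ 0ℤ
  shift zero    = refl
  shift (suc k) = refl

sumℤ-conv1 : ∀ k (a : ℕ → ℤ) → sumℤ k (λ i → a i ℤ.* coeff (1ℤ ∷ []) (k ∸ i)) ≡ a k
sumℤ-conv1 zero    a = ℤₚ.*-identityʳ _
sumℤ-conv1 (suc k) a = trans
  (cong₂ ℤ._+_ (ℤₚ.*-zeroʳ (a 0)) (sumℤ-conv1 k (a ∘ suc))) (ℤₚ.+-identityˡ _)

coeff-*1 : ∀ {p} q k → p ≈ₚ (1ℤ ∷ []) → coeff (q *ₚ p) k ≡ coeff q k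
coeff-*1 {p} q k e = trans (*ₚ-cong {q} {q} {p} {1ℤ ∷ []} (λ _ → refl) e k)
  (trans (coeff-* q (1ℤ ∷ []) k) (sumℤ-conv1 k (coeff q)))

sumℤ-last : ∀ n (s t : ℕ → ℤ) → (∀ i → i < n → s i ≡ t i) →
            sumℤ n s ℤ.+ t n ≡ sumℤ n t ℤ.+ s n
sumℤ-last zero    s t e = ℤₚ.+-comm (s 0) (t 0)
sumℤ-last (suc n) s t e = begin
  (s 0 ℤ.+ sumℤ n (s ∘ suc)) ℤ.+ t (suc n) ≡⟨ ℤₚ.+-assoc (s 0) _ _ ⟩
  s 0 ℤ.+ (sumℤ n (s ∘ suc) ℤ.+ t (suc n))
    ≡⟨ cong₂ ℤ._+_ (e 0 (s≤s z≤n)) (sumℤ-last n (s ∘ suc) (t ∘ suc) (λ i i<n → e (suc i) (s≤s i<n))) ⟩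
  t 0 ℤ.+ (sumℤ n (t ∘ suc) ℤ.+ s (suc n)) ≡⟨ ℤₚ.+-assoc (t 0) _ _ ⟨
  (t 0 ℤ.+ sumℤ n (t ∘ suc)) ℤ.+ s (suc n) ∎
  where open ≡-Reasoning

module ℤ-+ = GroupProperties (AbelianGroup.group ℤₚ.+-0-abelianGroup)

halve : ∀ (a b A B : ℤ) → a ℤ.+ A ≡ b ℤ.+ B → A ℤ.+ b ≡ B ℤ.+ a → a ≡ b
halve a b A B e₁ e₂ = ℤₚ.*-cancelˡ-≡ (+ 2) a b (ℤ-+.∙-cancelʳ (A ℤ.+ B) _ _ (begin
  + 2 ℤ.* a ℤ.+ (A ℤ.+ B)         ≡⟨ lemma₁ a A B ⟩
  (a ℤ.+ A) ℤ.+ (B ℤ.+ a)         ≡⟨ cong₂ ℤ._+_ e₁ (sym e₂) ⟩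
  (b ℤ.+ B) ℤ.+ (A ℤ.+ b)         ≡⟨ lemma₂ b A B ⟩
  + 2 ℤ.* b ℤ.+ (A ℤ.+ B)         ∎))
  where
  open ≡-Reasoning
  lemma₁ : ∀ a A B → + 2 ℤ.* a ℤ.+ (A ℤ.+ B) ≡ (a ℤ.+ A) ℤ.+ (B ℤ.+ a)
  lemma₁ = solve-∀
  lemma₂ : ∀ b A B → (b ℤ.+ B) ℤ.+ (A ℤ.+ b) ≡ + 2 ℤ.* b ℤ.+ (A ℤ.+ B)
  lemma₂ = solve-∀

√-unique : ∀ {f S T} → S Is√ f → T Is√ f → S ≈ T
√-unique {f} {S} {T} (S0 , SS) (T0 , TT) = <-rec (λ n → S n ≈ₚ T n) step
  where
  step : ∀ n → (∀ {m} → m < n → S m ≈ₚ T m) → S n ≈ₚ T n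
  step zero    ih k = trans (S0 k) (sym (T0 k))
  step (suc m) ih k = halve _ _ (sumℤ m (s S)) (sumℤ m (s T))
    (trans (sym (expand S S0)) (trans (trans (SS (suc m) k) (sym (TT (suc m) k))) (expand T T0)))
    (trans (cong (λ z → sumℤ m (s S) ℤ.+ z) (sym (end T T0)))
      (trans (sumℤ-last m (s S) (s T)
        λ i i<m → *ₚ-cong {S (suc i)} {T (suc i)} {S (m ∸ i)} {T (m ∸ i)}
          (ih (s≤s i<m)) (ih (s≤s (ℕₚ.m∸n≤m m i))) k)
      (cong (λ z → sumℤ m (s T) ℤ.+ z) (end S S0))))
    where
    s : Series → ℕ → ℤ
    s U i = coeff (U (suc i) *ₚ U (m ∸ i)) k

    expand : ∀ U → U 0 ≈ₚ (1ℤ ∷ []) →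
             coeff ((U * U) (suc m)) k ≡ coeff (U (suc m)) k ℤ.+ sumℤ m (s U)
    expand U U0 = trans (coeff-+ (U 0 *ₚ U (suc m)) _ k)
      (cong₂ ℤ._+_ (coeff-1* {U 0} (U (suc m)) k U0) (coeff-Σ m _ k))

    end : ∀ U → U 0 ≈ₚ (1ℤ ∷ []) → s U m ≡ coeff (U (suc m)) k
    end U U0 rewrite ℕₚ.n∸n≡0 m = coeff-*1 {U 0} (U (suc m)) k U0

{-# OPTIONS --safe #-}
module Submission where

-- A nonempty Catalan word is uniquely 0 (u + 1) v with u, v Catalan (first return to 0).
-- If u and v are both nonempty, the junction is a descent, so the word avoids (≠,>) exactly
-- when u and v do and u ends in a repeated letter; such u are the nonempty avoiding words
-- with their last letter doubled. Hence B = C − 1 satisfies B = x (1 + 2B + x y B²), and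
-- completing the square in this quadratic equation gives the closed form.

open import Defs
open import Data.Nat using (_>?_)
open import Data.Product using (∃-syntax; _×_)

open import Algebra.Bundles using (CommutativeRing; RawRing)
import Algebra.Construct.Pointwise as Pointwise
import Algebra.Morphism.RingMonomorphism as RingMonomorphism
open import Algebra.Morphism.Structures using (IsRingMonomorphism)
import Algebra.Properties.CommutativeSemigroup as CommutativeSemigroupProperties
import Algebra.Properties.Group as GroupProperties
import Algebra.Solver.Ring.NaturalCoefficients.Default as NaturalCoefficients
open import Data.Bool using (true; false; if_then_else_)
open import Data.Integer as ℤ using (0ℤ; 1ℤ)
import Data.Integer.Properties as ℤₚ
open import Data.List using
  (List; []; _∷_; _++_; map; length; head; concat; applyUpTo; cartesianProduct)
open import Data.List.Membership.Propositional using (_∈_)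
open import Data.List.Membership.Propositional.Properties using
  (∈-map⁺; ∈-map⁻; ∈-++⁺ˡ; ∈-++⁺ʳ; ∈-++⁻; ∈-concat⁺′; ∈-concat⁻′; ∈-applyUpTo⁺; ∈-applyUpTo⁻;
   ∈-cartesianProduct⁺; ∈-cartesianProduct⁻)
open import Data.List.Membership.Propositional.Properties.WithK using (unique∧set⇒bag)
open import Data.List.Properties using
  (length-map; length-++; map-∘; ++-identityʳ; ∷-injective; ∷-injectiveˡ; ∷-injectiveʳ)
open import Data.List.Relation.Binary.BagAndSetEquality using (∼bag⇒↭)
open import Data.List.Relation.Binary.Permutation.Propositional using (_↭_)
open import Data.List.Relation.Unary.All as All using (All; []; _∷_)
import Data.List.Relation.Unary.All.Properties as Allₚ
open import Data.List.Relation.Unary.AllPairs using ([]; _∷_)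
import Data.List.Relation.Unary.AllPairs.Properties as AllPairsₚ
open import Data.List.Relation.Unary.Linked as Linked using (Linked; []; [-]; _∷_)
import Data.List.Relation.Unary.Linked.Properties as Linkedₚ
open import Data.List.Relation.Unary.Unique.Propositional using (Unique)
import Data.List.Relation.Unary.Unique.Propositional.Properties as Uniqueₚ
open import Data.Maybe.Relation.Unary.All as Maybe using (just; nothing)
open import Data.Nat as ℕ using (ℕ; zero; suc; _≤_; _<_; _>_; _∸_; z≤n; s≤s)
import Data.Nat.Properties as ℕₚ
open import Data.Product using (_,_; proj₁; proj₂; uncurry)
open import Data.Sum using (_⊎_; inj₁; inj₂)
open import Function using (_∘_; id; _⇔_; mk⇔; Equivalence)
open import Level using (0ℓ)
open import Relation.Binary.PropositionalEquality as ≡ using (_≡_; _≢_; refl; cong; cong₂)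
import Relation.Binary.Reasoning.Setoid as SetoidReasoning
open import Relation.Nullary using (¬_; yes; no; contradiction)
open import Relation.Nullary.Decidable using (does)

-- A left block of one letter cannot be followed by a nonempty `v`: the letter before the junction
-- descent would be equal only to itself, and the one preceding it is the leading 0, which differs
-- from the positive block. This is why the doubled blocks have length at least two and exhaust the
-- case. In x (1 + 2B + x y B²) the outer x is the leading 0, the 1 is the word 0, 2B counts the
-- words with exactly one of u, v empty, the inner x is the doubled letter and y the junction
-- descent. The word 0 has both factors empty and would fall into both families behind 2B, so the
-- bijection is stated only for lengths m + 2.
--
-- No square root is constructed. The root is taken to be the series that makes the closed form,
-- with its denominator cleared, immediate; what remains is to square it.
--
-- Polynomials are lists with possible trailing zeros, and products of series use truncated
-- subtraction. The ring laws are therefore proved for coefficient functions and pulled back along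
-- maps that respect and reflect equality.

-- Formal power series over a commutative ring.

module PowerSeries (R : CommutativeRing 0ℓ 0ℓ) where

  open CommutativeRing R using (Carrier; 0#; 1#; setoid)
    renaming (_≈_ to _≋_; _+_ to _⊕_; _*_ to _⊗_)
  private
    module R = CommutativeRing R
    module + = CommutativeSemigroupProperties R.+-commutativeSemigroup
  open SetoidReasoning setoid

  -- The Cauchy product, from writing a series as its constant term plus the variable times
  -- `f ∘ suc`. No index n ∸ i occurs, so the ring laws follow by structural induction on n.
  conv : (ℕ → Carrier) → (ℕ → Carrier) → ℕ → Carrier
  conv f g zero    = f 0 ⊗ g 0
  conv f g (suc n) = f 0 ⊗ g (suc n) ⊕ conv (f ∘ suc) g n

  one : ℕ → Carrier
  one zero    = 1#
  one (suc _) = 0#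

  conv-cong : ∀ {f f′ g g′} → (∀ n → f n ≋ f′ n) → (∀ n → g n ≋ g′ n) →
              ∀ n → conv f g n ≋ conv f′ g′ n
  conv-cong e e′ zero    = R.*-cong (e 0) (e′ 0)
  conv-cong e e′ (suc n) =
    R.+-cong (R.*-cong (e 0) (e′ (suc n))) (conv-cong (e ∘ suc) e′ n)

  conv-zeroˡ : ∀ g n → conv (λ _ → 0#) g n ≋ 0#
  conv-zeroˡ g zero    = R.zeroˡ _
  conv-zeroˡ g (suc n) =
    R.trans (R.+-cong (R.zeroˡ _) (conv-zeroˡ g n)) (R.+-identityˡ _)

  conv-identityˡ : ∀ g n → conv one g n ≋ g n
  conv-identityˡ g zero    = R.*-identityˡ _
  conv-identityˡ g (suc n) =
    R.trans (R.+-cong (R.*-identityˡ _) (conv-zeroˡ g n)) (R.+-identityʳ _)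

  conv-distribʳ : ∀ h f g n →
                  conv (λ i → f i ⊕ g i) h n ≋ conv f h n ⊕ conv g h n
  conv-distribʳ h f g zero    = R.distribʳ _ _ _
  conv-distribʳ h f g (suc n) = R.trans
    (R.+-cong (R.distribʳ _ _ _) (conv-distribʳ h (f ∘ suc) (g ∘ suc) n))
    (+.interchange _ _ _ _)

  conv-scaleˡ : ∀ a f g n → conv (λ i → a ⊗ f i) g n ≋ a ⊗ conv f g n
  conv-scaleˡ a f g zero    = R.*-assoc _ _ _
  conv-scaleˡ a f g (suc n) = R.trans
    (R.+-cong (R.*-assoc _ _ _) (conv-scaleˡ a (f ∘ suc) g n))
    (R.sym (R.distribˡ _ _ _))

  -- The tail of `conv f g` unfolds to `f 0` times the tail of `g` plus `conv (f ∘ suc) g`, so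
  -- linearity in the left factor reduces the claim to the induction hypothesis for `f ∘ suc`.
  conv-assoc : ∀ f g h n → conv (conv f g) h n ≋ conv f (conv g h) n
  conv-assoc f g h zero    = R.*-assoc _ _ _
  conv-assoc f g h (suc n) = begin
    f 0 ⊗ g 0 ⊗ h (suc n) ⊕ conv (λ i → f 0 ⊗ g (suc i) ⊕ conv (f ∘ suc) g i) h n
      ≈⟨ R.+-cong (R.*-assoc _ _ _) (conv-distribʳ h _ _ n) ⟩
    f 0 ⊗ (g 0 ⊗ h (suc n)) ⊕
      (conv (λ i → f 0 ⊗ g (suc i)) h n ⊕ conv (conv (f ∘ suc) g) h n)
      ≈⟨ R.+-congˡ (R.+-cong (conv-scaleˡ (f 0) (g ∘ suc) h n)
                             (conv-assoc (f ∘ suc) g h n)) ⟩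
    f 0 ⊗ (g 0 ⊗ h (suc n)) ⊕
      (f 0 ⊗ conv (g ∘ suc) h n ⊕ conv (f ∘ suc) (conv g h) n)
      ≈⟨ R.+-assoc _ _ _ ⟨
    f 0 ⊗ (g 0 ⊗ h (suc n)) ⊕ f 0 ⊗ conv (g ∘ suc) h n ⊕ conv (f ∘ suc) (conv g h) n
      ≈⟨ R.+-congʳ (R.distribˡ _ _ _) ⟨
    f 0 ⊗ conv g h (suc n) ⊕ conv (f ∘ suc) (conv g h) n ∎

  -- The mirror image of the defining recursion, peeling the right factor; commutativity plays one
  -- against the other.
  conv-suc : ∀ f g n → conv f g (suc n) ≋ f (suc n) ⊗ g 0 ⊕ conv f (g ∘ suc) n
  conv-suc f g zero    = R.+-comm _ _
  conv-suc f g (suc n) =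
    R.trans (R.+-congˡ (conv-suc (f ∘ suc) g n)) (+.x∙yz≈y∙xz _ _ _)

  conv-comm : ∀ f g n → conv f g n ≋ conv g f n
  conv-comm f g zero    = R.*-comm _ _
  conv-comm f g (suc n) =
    R.trans (conv-suc f g n) (R.+-cong (R.*-comm _ _) (conv-comm f (g ∘ suc) n))

  commutativeRing : CommutativeRing 0ℓ 0ℓ
  commutativeRing = record
    { _≈_ = λ f g → ∀ n → f n ≋ g n
    ; _+_ = λ f g n → f n ⊕ g n
    ; _*_ = conv
    ; -_  = λ f n → R.- f n
    ; 0#  = λ _ → 0#
    ; 1#  = one
    ; isCommutativeRing = record
      { isRing = record
        { +-isAbelianGroup = Pointwise.isAbelianGroup ℕ R.+-isAbelianGroup
        ; *-cong     = conv-cong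
        ; *-assoc    = conv-assoc
        ; *-identity = conv-identityˡ
                     , λ f n → R.trans (conv-comm f one n) (conv-identityˡ f n)
        ; distrib    = (λ f g h n → R.trans (conv-comm f _ n)
                         (R.trans (conv-distribʳ f g h n)
                           (R.+-cong (conv-comm g f n) (conv-comm h f n))))
                     , conv-distribʳ
        }
      ; *-comm = conv-comm
      }
    }

-- The rings ℤ[y] and ℤ[y][[x]].

ℤ[[y]] : CommutativeRing 0ℓ 0ℓ
ℤ[[y]] = PowerSeries.commutativeRing ℤₚ.+-*-commutativeRing

rawPoly : RawRing 0ℓ 0ℓ
rawPoly = record
  { Carrier = Poly ; _≈_ = _≈ₚ_ ; _+_ = _+ₚ_ ; _*_ = _*ₚ_ ; -_ = -ₚ_ ; 0# = [] ; 1# = 1ℤ ∷ [] }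

coeff-- : ∀ p k → coeff (-ₚ p) k ≡ ℤ.- coeff p k
coeff-- []      k       = refl
coeff-- (a ∷ p) zero    = refl
coeff-- (a ∷ p) (suc k) = coeff-- p k

coeff-conv : ∀ p q k →
  coeff (p *ₚ q) k ≡ CommutativeRing._*_ ℤ[[y]] (coeff p) (coeff q) k
coeff-conv p q k = ≡.trans (coeff-* p q k) (sumℤ-conv (coeff p) (coeff q) k)
  where
  sumℤ-conv : ∀ f g k →
    sumℤ k (λ i → f i ℤ.* g (k ∸ i)) ≡ CommutativeRing._*_ ℤ[[y]] f g k
  sumℤ-conv f g zero    = refl
  sumℤ-conv f g (suc k) = cong (λ z → f 0 ℤ.* g (suc k) ℤ.+ z) (sumℤ-conv (f ∘ suc) g k)

-- Since `_≈ₚ_` is equality of all coefficients, `coeff` is injective by definition, and lists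
-- inherit the ring laws of ℤ[[y]].
coeff-isRingMonomorphism : IsRingMonomorphism rawPoly (CommutativeRing.rawRing ℤ[[y]]) coeff
coeff-isRingMonomorphism = record
  { isRingHomomorphism = record
    { isSemiringHomomorphism = record
      { isNearSemiringHomomorphism = record
        { +-isMonoidHomomorphism = record
          { isMagmaHomomorphism = record
            { isRelHomomorphism = record { cong = id }
            ; homo = coeff-+
            }
          ; ε-homo = λ _ → refl
          }
        ; *-homo = coeff-conv
        }
      ; 1#-homo = λ { zero → refl ; (suc _) → refl }
      }
    ; -‿homo = coeff--
    }
  ; injective = id
  }

ℤ[y] : CommutativeRing 0ℓ 0ℓ
ℤ[y] = record
  { isCommutativeRing = RingMonomorphism.isCommutativeRing coeff-isRingMonomorphism
      (CommutativeRing.isCommutativeRing ℤ[[y]]) }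

module ℤ[y] = CommutativeRing ℤ[y]

ℤ[y][[x]]′ : CommutativeRing 0ℓ 0ℓ
ℤ[y][[x]]′ = PowerSeries.commutativeRing ℤ[y]

rawSeries : RawRing 0ℓ 0ℓ
rawSeries = record
  { Carrier = Series ; _≈_ = _≈_ ; _+_ = _+_ ; _*_ = _*_
  ; -_ = λ f n → -ₚ f n ; 0# = λ _ → [] ; 1# = nat 1 }

Σ≤-conv : ∀ f g n → (f * g) n ≈ₚ CommutativeRing._*_ ℤ[y][[x]]′ f g n
Σ≤-conv f g zero    = ℤ[y].refl {f 0 *ₚ g 0}
Σ≤-conv f g (suc n) = ℤ[y].+-congˡ {f 0 *ₚ g (suc n)} (Σ≤-conv (f ∘ suc) g n)

-- The product by `Σ≤` and the recursive one agree up to `_≈ₚ_`. Transfer along the identity gives a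
-- ring whose operations are literally those of the theorem.
id-isRingMonomorphism : IsRingMonomorphism rawSeries (CommutativeRing.rawRing ℤ[y][[x]]′) id
id-isRingMonomorphism = record
  { isRingHomomorphism = record
    { isSemiringHomomorphism = record
      { isNearSemiringHomomorphism = record
        { +-isMonoidHomomorphism = record
          { isMagmaHomomorphism = record
            { isRelHomomorphism = record { cong = id }
            ; homo = λ _ _ _ _ → refl
            }
          ; ε-homo = λ _ _ → refl
          }
        ; *-homo = Σ≤-conv
        }
      ; 1#-homo = λ { zero _ → refl ; (suc _) _ → refl }
      }
    ; -‿homo = λ _ _ _ → refl
    }
  ; injective = id
  }

ℤ[y][[x]] : CommutativeRing 0ℓ 0ℓ
ℤ[y][[x]] = record
  { isCommutativeRing = RingMonomorphism.isCommutativeRing id-isRingMonomorphism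
      (CommutativeRing.isCommutativeRing ℤ[y][[x]]′) }

module 𝕊 = CommutativeRing ℤ[y][[x]]

x*-suc : ∀ f n → (x * f) (suc n) ≈ₚ f n
x*-suc f n = begin
  -- `x 0` is the empty list, so the first term of the convolution vanishes by computation.
  (x * f) (suc n)             ≡⟨⟩
  (x ∘ suc * f) n             ≈⟨ 𝕊.*-congʳ {f} {x ∘ suc} {nat 1} tail-x n ⟩
  (nat 1 * f) n               ≈⟨ 𝕊.*-identityˡ f n ⟩
  f n                         ∎
  where
  open SetoidReasoning ℤ[y].setoid
  tail-x : x ∘ suc ≈ nat 1
  tail-x zero    _ = refl
  tail-x (suc _) _ = refl

-- Completing the square in a commutative ring.

module Quadratic (R : CommutativeRing 0ℓ 0ℓ) where

  open CommutativeRing R using (Carrier; 1#; setoid)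
    renaming (_≈_ to infix 4 _≋_; _+_ to infixl 6 _⊕_; _*_ to infixl 7 _⊗_)
  private
    module R = CommutativeRing R
    module + = GroupProperties R.+-group
    open NaturalCoefficients R.commutativeSemiring using (solve; _:=_; _:+_; _:*_; con)
  open SetoidReasoning setoid

  2# 4# : Carrier
  2# = 1# ⊕ 1#
  4# = 1# ⊕ 1# ⊕ 1# ⊕ 1#

  -- t, u and s stand for x²y, x²yB and 1 − 2x − 2x²yB; the statements avoid subtraction, so
  -- that every step is a semiring identity.
  complete-square : ∀ {x t u} → u ≋ x ⊗ t ⊕ 2# ⊗ (x ⊗ u) ⊕ u ⊗ u →
    (x ⊕ t ⊕ u) ⊗ (x ⊕ t ⊕ u) ⊕ (t ⊕ t ⊗ t ⊕ (x ⊕ x ⊗ t)) ≋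
    x ⊗ x ⊕ (x ⊕ t ⊕ u) ⊗ (1# ⊕ 2# ⊗ t)
  complete-square {x} {t} {u} eq = begin
    (x ⊕ t ⊕ u) ⊗ (x ⊕ t ⊕ u) ⊕ (t ⊕ t ⊗ t ⊕ (x ⊕ x ⊗ t))
      ≈⟨ solve 3 (λ x t u →
           (x :+ t :+ u) :* (x :+ t :+ u) :+ (t :+ t :* t :+ (x :+ x :* t)) :=
           (x :* t :+ con 2 :* (x :* u) :+ u :* u) :+
             (x :* x :+ x :+ t :+ con 2 :* (t :* (x :+ t :+ u))))
           R.refl x t u ⟩
    (x ⊗ t ⊕ 2# ⊗ (x ⊗ u) ⊕ u ⊗ u) ⊕ (x ⊗ x ⊕ x ⊕ t ⊕ 2# ⊗ (t ⊗ (x ⊕ t ⊕ u)))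
      ≈⟨ R.+-congʳ eq ⟨
    u ⊕ (x ⊗ x ⊕ x ⊕ t ⊕ 2# ⊗ (t ⊗ (x ⊕ t ⊕ u)))
      ≈⟨ solve 3 (λ x t u →
           u :+ (x :* x :+ x :+ t :+ con 2 :* (t :* (x :+ t :+ u))) :=
           x :* x :+ (x :+ t :+ u) :* (con 1 :+ con 2 :* t))
           R.refl x t u ⟩
    x ⊗ x ⊕ (x ⊕ t ⊕ u) ⊗ (1# ⊕ 2# ⊗ t) ∎

  -- With `p` = 1 + 2t and `r` = x + t + u the second hypothesis says s = p - 2r, hence s² = p² -
  -- 4rp + 4r². Adding 4rp to both sides clears the subtraction, and `complete-square` produces the
  -- same 4rp on the right.
  square : ∀ {s x t u} → u ≋ x ⊗ t ⊕ 2# ⊗ (x ⊗ u) ⊕ u ⊗ u →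
    s ⊕ 2# ⊗ (x ⊕ t ⊕ u) ≋ 1# ⊕ 2# ⊗ t →
    s ⊗ s ⊕ 4# ⊗ (x ⊕ x ⊗ t) ≋ 1# ⊕ 4# ⊗ (x ⊗ x)
  square {s} {x} {t} {u} equ eqs = +.∙-cancelʳ (4# ⊗ (r ⊗ p)) _ _ (begin
    s ⊗ s ⊕ 4# ⊗ v ⊕ 4# ⊗ (r ⊗ p)
      ≈⟨ R.+-congˡ (R.*-congˡ (R.*-congˡ eqs)) ⟨
    s ⊗ s ⊕ 4# ⊗ v ⊕ 4# ⊗ (r ⊗ (s ⊕ 2# ⊗ r))
      ≈⟨ solve 3 (λ s r v →
           s :* s :+ con 4 :* v :+ con 4 :* (r :* (s :+ con 2 :* r)) :=
           (s :+ con 2 :* r) :* (s :+ con 2 :* r) :+ con 4 :* (r :* r :+ v))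
           R.refl s r v ⟩
    (s ⊕ 2# ⊗ r) ⊗ (s ⊕ 2# ⊗ r) ⊕ 4# ⊗ (r ⊗ r ⊕ v)
      ≈⟨ R.+-congʳ (R.*-cong eqs eqs) ⟩
    p ⊗ p ⊕ 4# ⊗ (r ⊗ r ⊕ v)
      ≈⟨ solve 3 (λ t r v →
           (con 1 :+ con 2 :* t) :* (con 1 :+ con 2 :* t) :+ con 4 :* (r :* r :+ v) :=
           con 1 :+ con 4 :* (r :* r :+ (t :+ t :* t :+ v)))
           R.refl t r v ⟩
    1# ⊕ 4# ⊗ (r ⊗ r ⊕ (t ⊕ t ⊗ t ⊕ v))
      ≈⟨ R.+-congˡ (R.*-congˡ (complete-square equ)) ⟩
    1# ⊕ 4# ⊗ (x ⊗ x ⊕ r ⊗ p)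
      ≈⟨ solve 2 (λ a b → con 1 :+ con 4 :* (a :+ b) := con 1 :+ con 4 :* a :+ con 4 :* b)
           R.refl (x ⊗ x) (r ⊗ p) ⟩
    1# ⊕ 4# ⊗ (x ⊗ x) ⊕ 4# ⊗ (r ⊗ p) ∎)
    where
    p = 1# ⊕ 2# ⊗ t
    r = x ⊕ t ⊕ u
    v = x ⊕ x ⊗ t

  telescope : ∀ p a r q → p R.- a ⊕ r R.- q ⊕ (a ⊕ q) ≋ p ⊕ r
  telescope p a r q = begin
    p R.- a ⊕ r R.- q ⊕ (a ⊕ q)
      -- The negatives enter the semiring identity as independent atoms and are cancelled
      -- afterwards.
      ≈⟨ solve 6 (λ p a′ r q′ a q →
           p :+ a′ :+ r :+ q′ :+ (a :+ q) := (p :+ r) :+ ((a′ :+ a) :+ (q′ :+ q)))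
           R.refl p (R.- a) r (R.- q) a q ⟩
    (p ⊕ r) ⊕ ((R.- a ⊕ a) ⊕ (R.- q ⊕ q))
      ≈⟨ R.+-congˡ (R.+-cong (R.-‿inverseˡ a) (R.-‿inverseˡ q)) ⟩
    (p ⊕ r) ⊕ (R.0# ⊕ R.0#)
      ≈⟨ R.trans (R.+-congˡ (R.+-identityˡ R.0#)) (R.+-identityʳ (p ⊕ r)) ⟩
    p ⊕ r ∎

  -- The shapes match the theorem: `x ^ 2` unfolds to x ⊗ (x ⊗ 1#), and `two`, `four` are parameters
  -- because `nat 2` and `nat 4` equal sums of ones only up to `_≈_`.
  discriminant : ∀ {x y b c two four} → two ≋ 2# → four ≋ 4# → c ≋ 1# ⊕ b →
    b ≋ x ⊗ (1# ⊕ (b ⊕ b) ⊕ x ⊗ (y ⊗ (b ⊗ b))) →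
    let x² = x ⊗ (x ⊗ 1#)
        x³ = x ⊗ x²
        s  = 1# R.- two ⊗ x ⊕ two ⊗ x² ⊗ y R.- two ⊗ x² ⊗ y ⊗ c
    in s ⊗ s ≋ 1# R.- four ⊗ x ⊕ four ⊗ x² R.- four ⊗ x³ ⊗ y
  discriminant {x} {y} {b} {c} {two} {four} e₂ e₄ ec eb =
    +.∙-cancelʳ (four ⊗ x ⊕ four ⊗ x³ ⊗ y) _ _ (begin
      s ⊗ s ⊕ (four ⊗ x ⊕ four ⊗ x³ ⊗ y)
        ≈⟨ R.+-congˡ (R.+-cong (R.*-congʳ e₄) (R.*-congʳ (R.*-congʳ e₄))) ⟩
      s ⊗ s ⊕ (4# ⊗ x ⊕ 4# ⊗ x³ ⊗ y)
        ≈⟨ R.+-congˡ (solve 2 (λ x y →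
             con 4 :* x :+ con 4 :* (x :* (x :* (x :* con 1))) :* y :=
             con 4 :* (x :+ x :* (x :* (x :* y))))
             R.refl x y) ⟩
      s ⊗ s ⊕ 4# ⊗ (x ⊕ x ⊗ t)
        ≈⟨ square equ eqs ⟩
      1# ⊕ 4# ⊗ (x ⊗ x)
        ≈⟨ R.+-congˡ (R.*-cong (R.sym e₄) (R.*-congˡ (R.sym (R.*-identityʳ x)))) ⟩
      1# ⊕ four ⊗ x²
        ≈⟨ telescope 1# (four ⊗ x) (four ⊗ x²) (four ⊗ x³ ⊗ y) ⟨
      1# R.- four ⊗ x ⊕ four ⊗ x² R.- four ⊗ x³ ⊗ y ⊕ (four ⊗ x ⊕ four ⊗ x³ ⊗ y) ∎)
    where
    x² = x ⊗ (x ⊗ 1#)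
    x³ = x ⊗ x²
    s  = 1# R.- two ⊗ x ⊕ two ⊗ x² ⊗ y R.- two ⊗ x² ⊗ y ⊗ c
    t  = x ⊗ (x ⊗ y)
    u  = t ⊗ b

    -- Multiplying the equation of b by t = x²y makes it monic in u = tb: the term x²yb² becomes
    -- t²b² = u².
    equ : u ≋ x ⊗ t ⊕ 2# ⊗ (x ⊗ u) ⊕ u ⊗ u
    equ = R.trans (R.*-congˡ eb) (solve 3 (λ x y b →
      x :* (x :* y) :* (x :* (con 1 :+ (b :+ b) :+ x :* (y :* (b :* b)))) :=
      x :* (x :* (x :* y)) :+ con 2 :* (x :* (x :* (x :* y) :* b)) :+
        x :* (x :* y) :* b :* (x :* (x :* y) :* b))
      R.refl x y b)

    -- Here t + u = x²yc, so 2 (x + t + u) collects exactly the subtracted terms of s.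
    eqs : s ⊕ 2# ⊗ (x ⊕ t ⊕ u) ≋ 1# ⊕ 2# ⊗ t
    eqs = begin
      s ⊕ 2# ⊗ (x ⊕ t ⊕ u)
        ≈⟨ R.+-congˡ (solve 3 (λ x y b →
             con 2 :* (x :+ x :* (x :* y) :+ x :* (x :* y) :* b) :=
             con 2 :* x :+ con 2 :* (x :* (x :* con 1)) :* y :* (con 1 :+ b))
             R.refl x y b) ⟩
      s ⊕ (2# ⊗ x ⊕ 2# ⊗ x² ⊗ y ⊗ (1# ⊕ b))
        ≈⟨ R.+-congˡ (R.+-cong (R.*-congʳ e₂) (R.*-cong (R.*-congʳ (R.*-congʳ e₂)) ec)) ⟨
      s ⊕ (two ⊗ x ⊕ two ⊗ x² ⊗ y ⊗ c)
        ≈⟨ telescope 1# (two ⊗ x) (two ⊗ x² ⊗ y) (two ⊗ x² ⊗ y ⊗ c) ⟩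
      1# ⊕ two ⊗ x² ⊗ y
        ≈⟨ R.+-congˡ (R.*-congʳ (R.*-congʳ e₂)) ⟩
      1# ⊕ 2# ⊗ x² ⊗ y
        ≈⟨ solve 2 (λ x y →
             con 1 :+ con 2 :* (x :* (x :* con 1)) :* y := con 1 :+ con 2 :* (x :* (x :* y)))
             R.refl x y ⟩
      1# ⊕ 2# ⊗ t ∎

-- First-return decomposition and doubled last letters.

Step : ℕ → ℕ → Set
Step a b = b ≤ suc a

Bad : Word → Set
Bad = Contains _≢_ _>_

Good : Word → Set
Good w = Catalan w × Avoids _≢_ _>_ w

-- The half of `Catalan` that, required of the right factor, makes the decomposition unique.
ZeroHead : Word → Set
ZeroHead w = Maybe.All (_≡ 0) (head w)

glue : Word → Word → Word
glue u v = 0 ∷ map suc u ++ v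

-- `go` carries the previous letter, so the head of `repeatLast (a ∷ w)` is `a` by computation,
-- whether or not `w` is empty.
repeatLast : Word → Word
repeatLast []      = []
repeatLast (a ∷ w) = a ∷ go a w
  where
  go : ℕ → Word → Word
  go a []      = a ∷ []
  go a (b ∷ w) = b ∷ go b w

Bad-map⁺ : ∀ {w} → Bad w → Bad (map suc w)
Bad-map⁺ (here p q) = here (p ∘ ℕₚ.suc-injective) (s≤s q)
Bad-map⁺ (there c)  = there (Bad-map⁺ c)

Bad-map⁻ : ∀ w → Bad (map suc w) → Bad w
Bad-map⁻ (a ∷ b ∷ c ∷ w) (here p (s≤s q)) = here (p ∘ cong suc) q
Bad-map⁻ (a ∷ w)         (there c)        = there (Bad-map⁻ w c)

Bad-++⁺ˡ : ∀ {w} v → Bad w → Bad (w ++ v)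
Bad-++⁺ˡ v (here p q) = here p q
Bad-++⁺ˡ v (there c)  = there (Bad-++⁺ˡ v c)

Bad-++⁺ʳ : ∀ u {w} → Bad w → Bad (u ++ w)
Bad-++⁺ʳ []      c = c
Bad-++⁺ʳ (a ∷ u) c = there (Bad-++⁺ʳ u c)

Bad-repeatLast⁺ : ∀ {w} → Bad w → Bad (repeatLast w)
Bad-repeatLast⁺ (here p q) = here p q
Bad-repeatLast⁺ {a ∷ b ∷ w} (there c) = there (Bad-repeatLast⁺ c)

-- A descent at the end of the left block is preceded by two equal letters.
Bad-repeatLast-++⁻ : ∀ a w v → Bad (map suc (repeatLast (a ∷ w)) ++ 0 ∷ v) →
                     Bad (a ∷ w) ⊎ Bad (0 ∷ v)
Bad-repeatLast-++⁻ a []          v (here p q)         = contradiction refl p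
Bad-repeatLast-++⁻ a []          (b ∷ v) (there (here p ()))
Bad-repeatLast-++⁻ a []          v (there (there c))  = inj₂ c
Bad-repeatLast-++⁻ a (b ∷ [])    v (here p (s≤s q))   = contradiction q (ℕₚ.<-irrefl refl)
Bad-repeatLast-++⁻ a (b ∷ d ∷ w) v (here p (s≤s q))   = inj₁ (here (p ∘ cong suc) q)
Bad-repeatLast-++⁻ a (b ∷ w)     v (there c) with Bad-repeatLast-++⁻ b w v c
... | inj₁ c′ = inj₁ (there c′)
... | inj₂ c′ = inj₂ c′

-- The only new triple ends in the doubled letter, which is no descent.
Bad-repeatLast⁻ : ∀ a w → Bad (repeatLast (a ∷ w)) → Bad (a ∷ w)
Bad-repeatLast⁻ a []          (there (there ()))
Bad-repeatLast⁻ a (b ∷ [])    (here p q) = contradiction q (ℕₚ.<-irrefl refl)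
Bad-repeatLast⁻ a (b ∷ d ∷ w) (here p q) = here p q
Bad-repeatLast⁻ a (b ∷ w)     (there c)  = there (Bad-repeatLast⁻ b w c)

Linked-repeatLast⁺ : ∀ {w} → Linked Step w → Linked Step (repeatLast w)
Linked-repeatLast⁺ []               = []
Linked-repeatLast⁺ [-]              = ℕₚ.n≤1+n _ ∷ [-]
Linked-repeatLast⁺ {a ∷ b ∷ w} (p ∷ l) = p ∷ Linked-repeatLast⁺ l

Linked-repeatLast⁻ : ∀ w → Linked Step (repeatLast w) → Linked Step w
Linked-repeatLast⁻ []          l       = []
Linked-repeatLast⁻ (a ∷ [])    l       = [-]
Linked-repeatLast⁻ (a ∷ b ∷ w) (p ∷ l) = p ∷ Linked-repeatLast⁻ (b ∷ w) l

Linked-++⁻ˡ : ∀ u {v} → Linked Step (u ++ v) → Linked Step u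
Linked-++⁻ˡ []          l       = []
Linked-++⁻ˡ (a ∷ [])    l       = [-]
Linked-++⁻ˡ (a ∷ b ∷ u) (p ∷ l) = p ∷ Linked-++⁻ˡ (b ∷ u) l

Linked-++⁻ʳ : ∀ u {v} → Linked Step (u ++ v) → Linked Step v
Linked-++⁻ʳ []      l = l
Linked-++⁻ʳ (a ∷ u) l = Linked-++⁻ʳ u (Linked.tail l)

-- A step down to 0 is allowed from every letter.
Linked-++-zero⁺ : ∀ {u v} → ZeroHead v → Linked Step u → Linked Step v → Linked Step (u ++ v)
Linked-++-zero⁺ z                   []      lv = lv
Linked-++-zero⁺ {v = []}    z       [-]     lv = [-]
Linked-++-zero⁺ {v = _ ∷ _} (just refl) [-] lv = z≤n ∷ lv
Linked-++-zero⁺ z (p ∷ lu) lv = p ∷ Linked-++-zero⁺ z lu lv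

Catalan-glue⁺ : ∀ {u v} → Catalan u → Catalan v → Catalan (glue u v)
Catalan-glue⁺ {u} (zu , lu) (zv , lv) = just refl , Linked-++-zero⁺ zv (lift u zu lu) lv
  where
  lift : ∀ u → ZeroHead u → Linked Step u → Linked Step (0 ∷ map suc u)
  lift []      z           l = [-]
  lift (a ∷ u) (just refl) l = s≤s z≤n ∷ Linkedₚ.map⁺ (Linked.map s≤s l)

Catalan-glue⁻ : ∀ u {v} → ZeroHead v → Catalan (glue u v) → Catalan u × Catalan v
Catalan-glue⁻ u z (_ , l) =
  unlift u (Linked-++⁻ˡ (0 ∷ map suc u) l) , z , Linked-++⁻ʳ (0 ∷ map suc u) l
  where
  unlift : ∀ u → Linked Step (0 ∷ map suc u) → Catalan u
  unlift []      l               = nothing , []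
  -- The step from the leading 0 gives a + 1 ≤ 1, which forces a = 0.
  unlift (a ∷ u) (s≤s z≤n ∷ l) = just refl , Linked.map ℕ.s≤s⁻¹ (Linkedₚ.map⁻ l)

-- `map suc u` is the longest prefix of positive letters.
first-return : ∀ w → ∃[ u ] ∃[ v ] w ≡ map suc u ++ v × ZeroHead v
first-return []          = [] , [] , refl , nothing
first-return (zero ∷ w)  = [] , zero ∷ w , refl , just refl
first-return (suc a ∷ w) with first-return w
... | u , v , refl , z = a ∷ u , v , refl , z

-- The letters of the left block are positive and `v` can only begin with 0, so the boundary can be
-- read off the word.
map-suc-++-injective : ∀ u u′ {v v′} → ZeroHead v → ZeroHead v′ →
  map suc u ++ v ≡ map suc u′ ++ v′ → (u , v) ≡ (u′ , v′)
map-suc-++-injective []      []       z z′ refl = refl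
map-suc-++-injective []      (a ∷ u′) (just ()) z′ refl
map-suc-++-injective (a ∷ u) []       z (just ()) refl
map-suc-++-injective (a ∷ u) (b ∷ u′) z z′ eq with ∷-injective eq
... | refl , eq′ with map-suc-++-injective u u′ z z′ eq′
... | refl = refl

-- Otherwise the descent from u down to the 0 after it follows two distinct letters.
ends-repeated : ∀ a b u v → Avoids _≢_ _>_ (map suc (a ∷ b ∷ u) ++ 0 ∷ v) →
  ∃[ w ] ∃[ c ] a ∷ b ∷ u ≡ repeatLast (c ∷ w)
ends-repeated a b [] v av with a ℕ.≟ b
... | yes refl = [] , a , refl
... | no a≢b   = contradiction (here (a≢b ∘ ℕₚ.suc-injective) (s≤s z≤n)) av
ends-repeated a b (d ∷ u) v av with ends-repeated b d u v (av ∘ there)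
... | w , c , eq with ≡.cong head eq
... | refl = b ∷ w , a , cong (a ∷_) eq

repeatLast-injective : ∀ {u v} → repeatLast u ≡ repeatLast v → u ≡ v
repeatLast-injective {[]}        {[]}        refl = refl
repeatLast-injective {a ∷ []}    {b ∷ []}    refl = refl
-- Against a one-letter word the other one is split until `go` computes and the lengths visibly
-- differ.
repeatLast-injective {a ∷ []}    {b ∷ c ∷ []} ()
repeatLast-injective {a ∷ c ∷ u} {b ∷ d ∷ v} eq =
  cong₂ _∷_ (∷-injectiveˡ eq) (repeatLast-injective (∷-injectiveʳ eq))
repeatLast-injective {a ∷ c ∷ []} {b ∷ []} ()
repeatLast-injective {a ∷ c ∷ d ∷ u} {b ∷ []} ()
repeatLast-injective {a ∷ []}    {b ∷ c ∷ d ∷ v} ()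

length-repeatLast : ∀ a w → length (repeatLast (a ∷ w)) ≡ suc (length (a ∷ w))
length-repeatLast a []      = refl
length-repeatLast a (b ∷ w) = cong suc (length-repeatLast b w)

length-glue : ∀ u v → length (glue u v) ≡ suc (length u ℕ.+ length v)
length-glue u v = cong suc
  (≡.trans (length-++ (map suc u)) (cong (ℕ._+ length v) (length-map suc u)))

des-map-suc : ∀ w → des (map suc w) ≡ des w
des-map-suc []      = refl
des-map-suc (a ∷ []) = refl
des-map-suc (a ∷ b ∷ w) =
  cong (λ d → if does (a >? b) then suc d else d) (des-map-suc (b ∷ w))

des-glue-[]ˡ : ∀ {v} → ZeroHead v → des (glue [] v) ≡ des v
des-glue-[]ˡ {[]}    _           = refl
des-glue-[]ˡ {_ ∷ _} (just refl) = refl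

des-glue-[]ʳ : ∀ u → des (glue u []) ≡ des u
des-glue-[]ʳ []      = refl
des-glue-[]ʳ (a ∷ u) = ≡.trans (cong (des ∘ (suc a ∷_)) (++-identityʳ (map suc u))) (des-map-suc (a ∷ u))

-- The leading 0 and the doubled letter create no descent; the junction creates exactly one.
des-glue-repeatLast : ∀ a u v → des (glue (repeatLast (a ∷ u)) (0 ∷ v)) ≡
                      suc (des (a ∷ u) ℕ.+ des (0 ∷ v))
des-glue-repeatLast a u v = go a u
  where
  a≯a : ∀ a → does (a >? a) ≡ false
  a≯a zero    = refl
  a≯a (suc a) = a≯a a
  go : ∀ a u → des (map suc (repeatLast (a ∷ u)) ++ 0 ∷ v) ≡
               suc (des (a ∷ u) ℕ.+ des (0 ∷ v))
  go a [] rewrite a≯a a = refl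
  go a (b ∷ u) with does (a >? b)
  ... | true  = cong suc (go b u)
  ... | false = go b u

ZeroHead-repeatLast⁻ : ∀ {w} → ZeroHead (repeatLast w) → ZeroHead w
ZeroHead-repeatLast⁻ {[]}    z = z
ZeroHead-repeatLast⁻ {_ ∷ _} z = z

Good-repeatLast⁻ : ∀ {w} → Good (repeatLast w) → Good w
Good-repeatLast⁻ {w} ((z , l) , av) =
  (ZeroHead-repeatLast⁻ {w} z , Linked-repeatLast⁻ w l) , av ∘ Bad-repeatLast⁺

Good-repeatLast⁺ : ∀ {w} → Good w → Good (repeatLast w)
Good-repeatLast⁺ {[]}    g              = g
Good-repeatLast⁺ {a ∷ w} ((z , l) , av) =
  (z , Linked-repeatLast⁺ l) , av ∘ Bad-repeatLast⁻ a w

Good-glue⁻ : ∀ u {v} → ZeroHead v → Good (glue u v) → Good u × Good v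
Good-glue⁻ u {v} z (c , av) with Catalan-glue⁻ u z c
... | cu , cv = (cu , av ∘ there ∘ Bad-++⁺ˡ v ∘ Bad-map⁺)
              , (cv , av ∘ there ∘ Bad-++⁺ʳ (map suc u))

Good-glue-[]ˡ : ∀ {v} → Good v → Good (glue [] v)
Good-glue-[]ˡ {v} (c , av) = Catalan-glue⁺ (nothing , []) c , avoids v c av
  where
  avoids : ∀ v → Catalan v → Avoids _≢_ _>_ v → Avoids _≢_ _>_ (0 ∷ v)
  avoids (_ ∷ _) (just refl , _) av (here p q) = p refl
  avoids v       c               av (there b)  = av b

-- A forbidden triple at the leading 0 would need a descent from the letter 1 to a positive letter.
Good-glue-[]ʳ : ∀ {u} → Good u → Good (glue u [])
Good-glue-[]ʳ {u} (c , av) rewrite ++-identityʳ (map suc u) =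
  ≡.subst Catalan (cong (0 ∷_) (++-identityʳ (map suc u))) (Catalan-glue⁺ {u} {[]} c (nothing , []))
  , avoids u c av
  where
  avoids : ∀ u → Catalan u → Avoids _≢_ _>_ u → Avoids _≢_ _>_ (0 ∷ map suc u)
  avoids (_ ∷ _ ∷ _) (just refl , _) av (here p (s≤s ()))
  avoids u           c               av (there b) = av (Bad-map⁻ u b)

-- Doubling gives the left block at least two letters, so the triple at the leading 0 has a positive
-- third letter and no descent from 1. The other triples fall to `Bad-repeatLast-++⁻`.
Good-glue-repeatLast : ∀ {a u b v} → Good (a ∷ u) → Good (b ∷ v) →
                       Good (glue (repeatLast (a ∷ u)) (b ∷ v))
Good-glue-repeatLast {a} {u} {b} {v} gu@((just refl , _) , avu) ((just refl , l) , avv) =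
  Catalan-glue⁺ {repeatLast (a ∷ u)} (proj₁ (Good-repeatLast⁺ gu)) (just refl , l) , avoids u avu
  where
  avoids : ∀ u → Avoids _≢_ _>_ (0 ∷ u) → Avoids _≢_ _>_ (glue (repeatLast (0 ∷ u)) (0 ∷ v))
  avoids []      avu (here p (s≤s ()))
  avoids (_ ∷ u) avu (here p (s≤s ()))
  avoids u       avu (there c) with Bad-repeatLast-++⁻ 0 u v c
  ... | inj₁ c′ = avu c′
  ... | inj₂ c′ = avv c′

glue-cases : ∀ u v → ZeroHead v → Good (glue u v) →
  u ≡ [] ⊎ v ≡ [] ⊎ ∃[ w ] u ≡ repeatLast w × 0 < length w × 0 < length v
glue-cases []          v       z           g        = inj₁ refl
glue-cases (a ∷ u)     []      z           g        = inj₂ (inj₁ refl)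
-- The word would begin with the forbidden triple 0, a + 1, 0.
glue-cases (a ∷ [])    (_ ∷ v) (just refl) (_ , av) =
  contradiction (here (λ ()) (s≤s z≤n)) av
glue-cases (a ∷ b ∷ u) (_ ∷ v) (just refl) (_ , av) with ends-repeated a b u v (av ∘ there)
... | w , c , eq = inj₂ (inj₂ (c ∷ w , eq , s≤s z≤n , s≤s z≤n))

-- The decomposition as a bijection between finite lists.

good : ℕ → List Word
good = avoiders _≢?_ _>?_

-- Dropping the empty word turns C into B and keeps both components of every pair in `blocks`
-- nonempty.
good⁺ : ℕ → List Word
good⁺ zero    = []
good⁺ (suc n) = good (suc n)

∈-good : ∀ n w → w ∈ good n ⇔ (length w ≡ n × Good w)
∈-good = ∈-avoiders _≢?_ _>?_

∈-good⁺⁺ : ∀ {w} → 0 < length w → Good w → w ∈ good⁺ (length w)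
∈-good⁺⁺ {w@(_ ∷ _)} _ g = Equivalence.from (∈-good _ w) (refl , g)

∈-good⁺⁻ : ∀ n {w} → w ∈ good⁺ n → length w ≡ n × 0 < length w × Good w
∈-good⁺⁻ (suc n) {w} w∈ with Equivalence.to (∈-good (suc n) w) w∈
... | eq , g = eq , ≡.subst (0 <_) (≡.sym eq) (s≤s z≤n) , g

good⁺-unique : ∀ n → Unique (good⁺ n)
good⁺-unique zero    = []
good⁺-unique (suc n) = avoiders-unique _≢?_ _>?_ (suc n)

block : ℕ → ℕ → List (Word × Word)
block m i = cartesianProduct (good⁺ i) (good⁺ (m ∸ i))

-- Grouped by the length of the left word, in the order in which `Σ≤` sums the Cauchy product
-- `B * B`.
blocks : ℕ → List (Word × Word)
blocks m = concat (applyUpTo (block m) (suc m))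

∈-blocks⁺ : ∀ {u v} → 0 < length u → 0 < length v → Good u → Good v →
            (u , v) ∈ blocks (length u ℕ.+ length v)
∈-blocks⁺ {u} {v} nu nv gu gv =
  ∈-concat⁺′
    (∈-cartesianProduct⁺ (∈-good⁺⁺ nu gu)
      (≡.subst (λ k → v ∈ good⁺ k) (≡.sym (ℕₚ.m+n∸m≡n (length u) (length v))) (∈-good⁺⁺ nv gv)))
    (∈-applyUpTo⁺ (block (length u ℕ.+ length v)) (s≤s (ℕₚ.m≤m+n (length u) (length v))))

∈-blocks⁻ : ∀ m {u v} → (u , v) ∈ blocks m →
  length u ℕ.+ length v ≡ m × (0 < length u × Good u) × (0 < length v × Good v)
∈-blocks⁻ m uv∈ with ∈-concat⁻′ (applyUpTo (block m) (suc m)) uv∈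
... | _ , uv∈′ , L∈ with ∈-applyUpTo⁻ (block m) {n = suc m} L∈
... | i , s≤s i≤m , refl with ∈-cartesianProduct⁻ (good⁺ i) (good⁺ (m ∸ i)) uv∈′
... | u∈ , v∈ with ∈-good⁺⁻ i u∈ | ∈-good⁺⁻ (m ∸ i) v∈
... | lu , gu | lv , gv = ≡.trans (cong₂ ℕ._+_ lu lv) (ℕₚ.m+[n∸m]≡n i≤m) , gu , gv

blocks-unique : ∀ m → Unique (blocks m)
blocks-unique m = Uniqueₚ.concat⁺
  (Allₚ.applyUpTo⁺₂ _ (suc m) (λ i → Uniqueₚ.cartesianProduct⁺ (good⁺-unique i) (good⁺-unique (m ∸ i))))
  (AllPairsₚ.applyUpTo⁺₁ _ (suc m) λ {i} {j} i<j _ (p∈ , q∈) →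
    ℕₚ.<⇒≢ i<j (≡.trans (≡.sym (length-fst i p∈)) (length-fst j q∈)))
  where
  length-fst : ∀ i {p} → p ∈ block m i → length (proj₁ p) ≡ i
  length-fst i p∈ = proj₁ (∈-good⁺⁻ i (proj₁ (∈-cartesianProduct⁻ (good⁺ i) (good⁺ (m ∸ i)) p∈)))

repeatLastˡ : Word × Word → Word × Word
repeatLastˡ (u , v) = repeatLast u , v

-- The pairs glued to words of length m + 2. The leading 0 takes one letter; in the last family the
-- doubled letter takes another, hence `blocks m`.
splits : ℕ → List (Word × Word)
splits m = map ([] ,_) (good (suc m)) ++ map (_, []) (good (suc m)) ++ map repeatLastˡ (blocks m)

data Split (m : ℕ) : Word × Word → Set where
  empty-left  : ∀ {v} → v ∈ good (suc m) → Split m ([] , v)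
  empty-right : ∀ {u} → u ∈ good (suc m) → Split m (u , [])
  repeated    : ∀ {u v} → (u , v) ∈ blocks m → Split m (repeatLast u , v)

∈-splits⁻ : ∀ m {p} → p ∈ splits m → Split m p
∈-splits⁻ m p∈ with ∈-++⁻ (map ([] ,_) (good (suc m))) p∈
... | inj₁ p∈₁ with ∈-map⁻ _ p∈₁
...   | _ , v∈ , refl = empty-left v∈
∈-splits⁻ m p∈ | inj₂ p∈′ with ∈-++⁻ (map (_, []) (good (suc m))) p∈′
... | inj₁ p∈₂ with ∈-map⁻ _ p∈₂
...   | _ , u∈ , refl = empty-right u∈
∈-splits⁻ m p∈ | inj₂ p∈′ | inj₂ p∈₃ with ∈-map⁻ _ p∈₃
...   | _ , q∈ , refl = repeated q∈

∈-splits⁺ : ∀ m {p} → Split m p → p ∈ splits m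
∈-splits⁺ m (empty-left v∈)  = ∈-++⁺ˡ (∈-map⁺ _ v∈)
∈-splits⁺ m (empty-right u∈) =
  ∈-++⁺ʳ (map ([] ,_) (good (suc m))) (∈-++⁺ˡ (∈-map⁺ _ u∈))
∈-splits⁺ m (repeated q∈)    =
  ∈-++⁺ʳ (map ([] ,_) (good (suc m))) (∈-++⁺ʳ (map (_, []) (good (suc m))) (∈-map⁺ repeatLastˡ q∈))

[]∉good : ∀ {m} → ¬ [] ∈ good (suc m)
[]∉good {m} []∈ with () ← proj₁ (∈-good⁺⁻ (suc m) []∈)

repeatLastˡ-injective : ∀ {p q} → repeatLastˡ p ≡ repeatLastˡ q → p ≡ q
repeatLastˡ-injective eq = cong₂ _,_ (repeatLast-injective (cong proj₁ eq)) (cong proj₂ eq)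

repeatLast≡[] : ∀ {w} → [] ≡ repeatLast w → ¬ 0 < length w
repeatLast≡[] {_ ∷ _} () _

splits-unique : ∀ m → Unique (splits m)
splits-unique m = Uniqueₚ.++⁺
  (Uniqueₚ.map⁺ (cong proj₂) (avoiders-unique _≢?_ _>?_ (suc m)))
  (Uniqueₚ.++⁺
    (Uniqueₚ.map⁺ (cong proj₁) (avoiders-unique _≢?_ _>?_ (suc m)))
    (Uniqueₚ.map⁺ repeatLastˡ-injective (blocks-unique m))
    right≢repeated)
  left≢rest
  where
  right≢repeated : ∀ {p} → ¬ (p ∈ map (_, []) (good (suc m)) × p ∈ map repeatLastˡ (blocks m))
  right≢repeated (p∈ , q∈) with ∈-map⁻ _ p∈ | ∈-map⁻ _ q∈
  ... | _ , _ , refl | (u , v) , uv∈ , eq with cong proj₂ eq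
  ... | refl with () ← proj₁ (proj₂ (proj₂ (∈-blocks⁻ m uv∈)))

  left≢rest : ∀ {p} → ¬ (p ∈ map ([] ,_) (good (suc m)) ×
                         p ∈ map (_, []) (good (suc m)) ++ map repeatLastˡ (blocks m))
  left≢rest (p∈ , q∈) with ∈-map⁻ _ p∈ | ∈-++⁻ (map (_, []) (good (suc m))) q∈
  ... | _ , _ , refl | inj₁ q∈₂ with ∈-map⁻ _ q∈₂
  ...   | _ , u∈ , refl = []∉good {m} u∈
  left≢rest (p∈ , q∈) | _ , _ , refl | inj₂ q∈₃ with ∈-map⁻ _ q∈₃
  ...   | (u , v) , uv∈ , eq =
    repeatLast≡[] (cong proj₁ eq) (proj₁ (proj₁ (proj₂ (∈-blocks⁻ m uv∈))))

Split-sound : ∀ {m u v} → Split m (u , v) →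
  length (glue u v) ≡ suc (suc m) × Good (glue u v) × ZeroHead v
Split-sound {m} (empty-left {v} v∈) with Equivalence.to (∈-good (suc m) v) v∈
... | eq , g = cong suc eq , Good-glue-[]ˡ g , proj₁ (proj₁ g)
Split-sound {m} (empty-right {u} u∈) with Equivalence.to (∈-good (suc m) u) u∈
... | eq , g = ≡.trans (length-glue u []) (cong suc (≡.trans (ℕₚ.+-identityʳ _) eq))
             , Good-glue-[]ʳ g , nothing
Split-sound {m} (repeated {u} {v} uv∈) = from-block u v (∈-blocks⁻ m uv∈)
  where
  from-block : ∀ u v → length u ℕ.+ length v ≡ m × (0 < length u × Good u) × (0 < length v × Good v) →
    length (glue (repeatLast u) v) ≡ suc (suc m) × Good (glue (repeatLast u) v) × ZeroHead v
  from-block (a ∷ u) (b ∷ v) (eq , (_ , gu) , (_ , gv)) =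
    ≡.trans (length-glue (repeatLast (a ∷ u)) (b ∷ v))
      (cong suc (≡.trans (cong (ℕ._+ length (b ∷ v)) (length-repeatLast a u)) (cong suc eq)))
    , Good-glue-repeatLast gu gv , proj₁ (proj₁ gv)

Split-complete : ∀ {m w} → length w ≡ suc (suc m) → Good w →
  ∃[ p ] Split m p × w ≡ uncurry glue p
Split-complete {m} {_ ∷ w} lw g@((just refl , _) , _) with first-return w
... | u , v , refl , z with glue-cases u v z g | Good-glue⁻ u z g
                        | ℕₚ.suc-injective (≡.trans (≡.sym (length-glue u v)) lw)
... | inj₁ refl               | _  , gv | eq =
  _ , empty-left (Equivalence.from (∈-good (suc m) v) (eq , gv)) , refl
... | inj₂ (inj₁ refl)        | gu , _  | eq =
  _ , empty-right (Equivalence.from (∈-good (suc m) u) (≡.trans (≡.sym (ℕₚ.+-identityʳ _)) eq , gu)) , refl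
... | inj₂ (inj₂ (w′@(a ∷ t) , refl , nw , nv)) | gu , gv | eq =
  _ , repeated (≡.subst (λ k → (w′ , v) ∈ blocks k)
        (ℕₚ.suc-injective (≡.trans (cong (ℕ._+ length v) (≡.sym (length-repeatLast a t))) eq))
        (∈-blocks⁺ nw nv (Good-repeatLast⁻ {w′} gu) gv)) , refl

-- Injectivity is asked only on `P` because `glue` is not injective on all pairs: the word 0 1 is
-- both `glue [] (1 ∷ [])` and `glue (0 ∷ []) []`.
map-unique : ∀ {A B : Set} {P : A → Set} (f : A → B) →
  (∀ {a b} → P a → P b → f a ≡ f b → a ≡ b) →
  ∀ {as} → All P as → Unique as → Unique (map f as)
map-unique f inj []         []       = []
map-unique f inj (pa ∷ ps) (a∉ ∷ u) =
  Allₚ.map⁺ (All.zipWith (λ (pb , a≢b) eq → a≢b (inj pa pb eq)) (ps , a∉)) ∷ map-unique f inj ps u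

unique∧same-elements⇒↭ : ∀ {A : Set} {as bs : List A} → Unique as → Unique bs →
  (∀ {a} → a ∈ as ⇔ a ∈ bs) → as ↭ bs
unique∧same-elements⇒↭ ua ub eq = ∼bag⇒↭ (unique∧set⇒bag ua ub eq)

good-↭ : ∀ m → good (suc (suc m)) ↭ map (uncurry glue) (splits m)
good-↭ m = unique∧same-elements⇒↭
  (avoiders-unique _≢?_ _>?_ (suc (suc m)))
  (map-unique {P = ZeroHead ∘ proj₂} (uncurry glue)
    (λ {p} {q} z z′ eq → map-suc-++-injective (proj₁ p) (proj₁ q) z z′ (∷-injectiveʳ eq))
    (All.tabulate (λ p∈ → proj₂ (proj₂ (Split-sound (∈-splits⁻ m p∈)))))
    (splits-unique m))
  (mk⇔ to from)
  where
  to : ∀ {w} → w ∈ good (suc (suc m)) → w ∈ map (uncurry glue) (splits m)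
  to {w} w∈ with Equivalence.to (∈-good (suc (suc m)) w) w∈
  ... | lw , g with Split-complete lw g
  ... | p , s , refl = ∈-map⁺ (uncurry glue) (∈-splits⁺ m s)

  from : ∀ {w} → w ∈ map (uncurry glue) (splits m) → w ∈ good (suc (suc m))
  from w∈ with ∈-map⁻ (uncurry glue) w∈
  ... | p , p∈ , refl with Split-sound (∈-splits⁻ m p∈)
  ... | l , g , _ = Equivalence.from (∈-good (suc (suc m)) _) (l , g)

-- Sums of powers of y over lists.

total : ∀ {A : Set} → (A → ℕ) → List A → Poly
total d as = sumₚ (map (λ a → y^ d a) as)

module ≈ₚ-Reasoning = SetoidReasoning ℤ[y].setoid

total-++ : ∀ {A : Set} (d : A → ℕ) as bs → total d (as ++ bs) ≈ₚ total d as +ₚ total d bs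
total-++ d []       bs = ℤ[y].refl {total d bs}
total-++ d (a ∷ as) bs = begin
  y^ d a +ₚ total d (as ++ bs)            ≈⟨ ℤ[y].+-congˡ {y^ d a} (total-++ d as bs) ⟩
  y^ d a +ₚ (total d as +ₚ total d bs)    ≈⟨ ℤ[y].+-assoc (y^ d a) (total d as) (total d bs) ⟨
  y^ d a +ₚ total d as +ₚ total d bs      ∎
  where open ≈ₚ-Reasoning

total-map : ∀ {A B : Set} (d : B → ℕ) (f : A → B) as → total d (map f as) ≡ total (d ∘ f) as
total-map d f as = cong sumₚ (≡.sym (map-∘ as))

total-cong : ∀ {A : Set} {d e : A → ℕ} {as} → All (λ a → d a ≡ e a) as → total d as ≡ total e as
total-cong []       = refl
total-cong (p ∷ ps) = cong₂ (λ k → y^ k +ₚ_) p (total-cong ps)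

total-↭ : ∀ {A : Set} (d : A → ℕ) {as bs} → as ↭ bs → total d as ≈ₚ total d bs
total-↭ d {as} _↭_.refl = ℤ[y].refl {total d as}
total-↭ d (_↭_.prep a p) = ℤ[y].+-congˡ {y^ d a} (total-↭ d p)
total-↭ d {_ ∷ _ ∷ as} {_ ∷ _ ∷ bs} (_↭_.swap a b p) = begin
  y^ d a +ₚ (y^ d b +ₚ total d as)  ≈⟨ ℤ[y].+-assoc (y^ d a) (y^ d b) (total d as) ⟨
  y^ d a +ₚ y^ d b +ₚ total d as
    ≈⟨ ℤ[y].+-cong {y^ d a +ₚ y^ d b} {y^ d b +ₚ y^ d a} {total d as} {total d bs}
         (ℤ[y].+-comm (y^ d a) (y^ d b)) (total-↭ d p) ⟩
  y^ d b +ₚ y^ d a +ₚ total d bs    ≈⟨ ℤ[y].+-assoc (y^ d b) (y^ d a) (total d bs) ⟩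
  y^ d b +ₚ (y^ d a +ₚ total d bs)  ∎
  where open ≈ₚ-Reasoning
total-↭ d {as} {bs} (_↭_.trans {ys = cs} p q) =
  ℤ[y].trans {total d as} {total d cs} {total d bs} (total-↭ d p) (total-↭ d q)

total-concat : ∀ {A : Set} (d : A → ℕ) (f : ℕ → List A) n →
  total d (concat (applyUpTo f (suc n))) ≈ₚ Σ≤ n (λ i → total d (f i))
total-concat d f zero    = begin
  total d (f 0 ++ [])  ≡⟨ cong (total d) (++-identityʳ (f 0)) ⟩
  total d (f 0)        ∎
  where open ≈ₚ-Reasoning
total-concat d f (suc n) = begin
  total d (f 0 ++ concat (applyUpTo (f ∘ suc) (suc n)))
    ≈⟨ total-++ d (f 0) _ ⟩
  total d (f 0) +ₚ total d (concat (applyUpTo (f ∘ suc) (suc n)))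
    ≈⟨ ℤ[y].+-congˡ {total d (f 0)} (total-concat d (f ∘ suc) n) ⟩
  total d (f 0) +ₚ Σ≤ n (λ i → total d (f (suc i)))  ∎
  where open ≈ₚ-Reasoning

y^-+ : ∀ k l → y^ (k ℕ.+ l) ≈ₚ y^ k *ₚ y^ l
y^-+ zero    l = ℤ[y].sym {y^ 0 *ₚ y^ l} {y^ l} (ℤ[y].*-identityˡ (y^ l))
y^-+ (suc k) l = begin
  0ℤ ∷ y^ (k ℕ.+ l)                                   ≈⟨ tail-cong (y^-+ k l) ⟩
  0ℤ ∷ (y^ k *ₚ y^ l)
    ≈⟨ ℤ[y].+-congʳ {0ℤ ∷ (y^ k *ₚ y^ l)} {map (0ℤ ℤ.*_) (y^ l)} {[]} zero-scale ⟨
  map (0ℤ ℤ.*_) (y^ l) +ₚ (0ℤ ∷ (y^ k *ₚ y^ l))       ∎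
  where
  open ≈ₚ-Reasoning
  tail-cong : ∀ {p q} → p ≈ₚ q → 0ℤ ∷ p ≈ₚ 0ℤ ∷ q
  tail-cong e zero    = refl
  tail-cong e (suc i) = e i
  zero-scale : map (0ℤ ℤ.*_) (y^ l) ≈ₚ []
  zero-scale i = coeff-scale 0ℤ (y^ l) i

total-shift : ∀ {A : Set} k (d : A → ℕ) as → total (λ a → k ℕ.+ d a) as ≈ₚ y^ k *ₚ total d as
total-shift k d []       = ℤ[y].sym {y^ k *ₚ []} {[]} (ℤ[y].zeroʳ (y^ k))
total-shift k d (a ∷ as) = begin
  y^ (k ℕ.+ d a) +ₚ total (λ b → k ℕ.+ d b) as
    ≈⟨ ℤ[y].+-cong {y^ (k ℕ.+ d a)} {y^ k *ₚ y^ d a}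
         {total (λ b → k ℕ.+ d b) as} {y^ k *ₚ total d as}
         (y^-+ k (d a)) (total-shift k d as) ⟩
  y^ k *ₚ y^ d a +ₚ y^ k *ₚ total d as
    ≈⟨ ℤ[y].distribˡ (y^ k) (y^ d a) (total d as) ⟨
  y^ k *ₚ (y^ d a +ₚ total d as)  ∎
  where open ≈ₚ-Reasoning

total-cartesianProduct : ∀ {A B : Set} (d : A → ℕ) (e : B → ℕ) as bs →
  total (λ (a , b) → d a ℕ.+ e b) (cartesianProduct as bs) ≈ₚ total d as *ₚ total e bs
total-cartesianProduct d e []       bs = ℤ[y].refl {[]}
total-cartesianProduct d e (a ∷ as) bs = begin
  total d+e (map (a ,_) bs ++ cartesianProduct as bs)
    ≈⟨ total-++ d+e (map (a ,_) bs) (cartesianProduct as bs) ⟩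
  total d+e (map (a ,_) bs) +ₚ total d+e (cartesianProduct as bs)
    ≡⟨ cong (_+ₚ total d+e (cartesianProduct as bs)) (total-map d+e (a ,_) bs) ⟩
  total (λ b → d a ℕ.+ e b) bs +ₚ total d+e (cartesianProduct as bs)
    ≈⟨ ℤ[y].+-cong {total (λ b → d a ℕ.+ e b) bs} {y^ d a *ₚ total e bs}
         {total d+e (cartesianProduct as bs)} {total d as *ₚ total e bs}
         (total-shift (d a) e bs) (total-cartesianProduct d e as bs) ⟩
  y^ d a *ₚ total e bs +ₚ total d as *ₚ total e bs
    ≈⟨ ℤ[y].distribʳ (total e bs) (y^ d a) (total d as) ⟨
  (y^ d a +ₚ total d as) *ₚ total e bs  ∎
  where
  open ≈ₚ-Reasoning
  d+e = λ (a , b) → d a ℕ.+ e b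

-- The functional equation and the closed form.

B : Series
B n = total des (good⁺ n)

C≈1+B : C _≢?_ _>?_ ≈ nat 1 + B
C≈1+B zero    _ = refl
C≈1+B (suc _) _ = refl

total-blocks : ∀ m → total (λ (u , v) → des u ℕ.+ des v) (blocks m) ≈ₚ (B * B) m
total-blocks m = begin
  total d+d (blocks m)                     ≈⟨ total-concat d+d (block m) m ⟩
  Σ≤ m (λ i → total d+d (block m i))       ≈⟨ Σ≤-cong m (λ i →
    total-cartesianProduct des des (good⁺ i) (good⁺ (m ∸ i))) ⟩
  (B * B) m                                ∎
  where
  open ≈ₚ-Reasoning
  d+d = λ (u , v) → des u ℕ.+ des v
  Σ≤-cong : ∀ n {f g : ℕ → Poly} → (∀ i → f i ≈ₚ g i) → Σ≤ n f ≈ₚ Σ≤ n g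
  Σ≤-cong zero        e = e 0
  Σ≤-cong (suc n) {f} {g} e = ℤ[y].+-cong {f 0} {g 0} {Σ≤ n (f ∘ suc)} {Σ≤ n (g ∘ suc)}
    (e 0) (Σ≤-cong n (λ i → e (suc i)))

B-suc-suc : ∀ m → B (suc (suc m)) ≈ₚ B (suc m) +ₚ B (suc m) +ₚ y^ 1 *ₚ (B * B) m
B-suc-suc m = begin
  total des (good (suc (suc m)))
    ≈⟨ total-↭ des (good-↭ m) ⟩
  total des (map (uncurry glue) (splits m))
    ≡⟨ total-map des (uncurry glue) (splits m) ⟩
  total des′ (splits m)
    ≈⟨ total-++ des′ lefts (rights ++ map repeatLastˡ (blocks m)) ⟩
  total des′ lefts +ₚ total des′ (rights ++ map repeatLastˡ (blocks m))
    ≈⟨ ℤ[y].+-congˡ {total des′ lefts} (total-++ des′ rights (map repeatLastˡ (blocks m))) ⟩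
  total des′ lefts +ₚ (total des′ rights +ₚ total des′ (map repeatLastˡ (blocks m)))
    ≡⟨ cong₂ _+ₚ_ left≡ (cong₂ _+ₚ_ right≡ repeated≡) ⟩
  B (suc m) +ₚ (B (suc m) +ₚ total (λ (u , v) → 1 ℕ.+ (des u ℕ.+ des v)) (blocks m))
    ≈⟨ ℤ[y].+-assoc (B (suc m)) (B (suc m)) _ ⟨
  B (suc m) +ₚ B (suc m) +ₚ total (λ (u , v) → 1 ℕ.+ (des u ℕ.+ des v)) (blocks m)
    ≈⟨ ℤ[y].+-congˡ {B (suc m) +ₚ B (suc m)} (total-shift 1 (λ (u , v) → des u ℕ.+ des v) (blocks m)) ⟩
  B (suc m) +ₚ B (suc m) +ₚ y^ 1 *ₚ total (λ (u , v) → des u ℕ.+ des v) (blocks m)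
    ≈⟨ ℤ[y].+-congˡ {B (suc m) +ₚ B (suc m)} (ℤ[y].*-congˡ {y^ 1}
         {total (λ (u , v) → des u ℕ.+ des v) (blocks m)} {(B * B) m} (total-blocks m)) ⟩
  B (suc m) +ₚ B (suc m) +ₚ y^ 1 *ₚ (B * B) m  ∎
  where
  open ≈ₚ-Reasoning
  des′   = des ∘ uncurry glue
  lefts  = map ([] ,_) (good (suc m))
  rights = map (_, []) (good (suc m))

  left≡ : total des′ lefts ≡ B (suc m)
  left≡ = ≡.trans (total-map des′ ([] ,_) (good (suc m))) (total-cong (All.tabulate λ {v} v∈ →
    des-glue-[]ˡ (proj₁ (proj₁ (proj₂ (Equivalence.to (∈-good (suc m) v) v∈))))))

  right≡ : total des′ rights ≡ B (suc m)
  right≡ = ≡.trans (total-map des′ (_, []) (good (suc m)))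
    (total-cong {as = good (suc m)} (All.tabulate λ {u} _ → des-glue-[]ʳ u))

  des-block : ∀ u v → (0 < length u × Good u) × (0 < length v × Good v) →
              des (glue (repeatLast u) v) ≡ suc (des u ℕ.+ des v)
  des-block (a ∷ u) (_ ∷ v) (_ , _ , (just refl , _) , _) = des-glue-repeatLast a u v

  repeated≡ : total des′ (map repeatLastˡ (blocks m)) ≡
              total (λ (u , v) → 1 ℕ.+ (des u ℕ.+ des v)) (blocks m)
  repeated≡ = ≡.trans (total-map des′ repeatLastˡ (blocks m)) (total-cong (All.tabulate λ {p} p∈ →
    des-block (proj₁ p) (proj₂ p) (proj₂ (∈-blocks⁻ m p∈))))

const-* : ∀ p f n → (const p * f) n ≈ₚ p *ₚ f n
const-* p f zero    = ℤ[y].refl {p *ₚ f 0}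
const-* p f (suc n) = begin
  p *ₚ f (suc n) +ₚ ((λ _ → []) * f) n  ≈⟨ ℤ[y].+-congˡ {p *ₚ f (suc n)} (𝕊.zeroˡ f n) ⟩
  p *ₚ f (suc n) +ₚ []                  ≈⟨ ℤ[y].+-identityʳ (p *ₚ f (suc n)) ⟩
  p *ₚ f (suc n)                        ∎
  where open ≈ₚ-Reasoning

B-functional-equation : B ≈ x * (nat 1 + (B + B) + x * (y * (B * B)))
B-functional-equation zero          _ = refl
-- The word 0, outside the range of `good-↭`, accounts for the summand `nat 1`; both sides compute
-- to 1.
B-functional-equation (suc zero)      = ℤ[y].sym {(x * f) 1} {B 1} (x*-suc f 0)
  where f = nat 1 + (B + B) + x * (y * (B * B))
B-functional-equation (suc (suc m)) = begin
  B (suc (suc m))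
    ≈⟨ B-suc-suc m ⟩
  B (suc m) +ₚ B (suc m) +ₚ y^ 1 *ₚ (B * B) m
    ≈⟨ ℤ[y].+-congˡ {B (suc m) +ₚ B (suc m)} (const-* (y^ 1) (B * B) m) ⟨
  B (suc m) +ₚ B (suc m) +ₚ (y * (B * B)) m
    ≈⟨ ℤ[y].+-congˡ {B (suc m) +ₚ B (suc m)} (x*-suc (y * (B * B)) m) ⟨
  B (suc m) +ₚ B (suc m) +ₚ (x * (y * (B * B))) (suc m)
    ≈⟨ x*-suc (nat 1 + (B + B) + x * (y * (B * B))) (suc m) ⟨
  (x * (nat 1 + (B + B) + x * (y * (B * B)))) (suc (suc m))  ∎
  where open ≈ₚ-Reasoning

theorem3p39 : ∃[ S ] (S Is√ (nat 1 - nat 4 * x + nat 4 * x ^ 2 - nat 4 * x ^ 3 * y))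
    × ((nat 2 * x ^ 2 * y) * C _≢?_ _>?_ ≈ nat 1 - nat 2 * x + nat 2 * x ^ 2 * y - S)
theorem3p39 = S , (S₀ , S*S) , numerator
  where
  open Quadratic ℤ[y][[x]] using (2#; 4#; discriminant)

  W A S : Series
  W = (nat 2 * x ^ 2 * y) * C _≢?_ _>?_
  A = nat 1 - nat 2 * x + nat 2 * x ^ 2 * y
  -- With this choice `numerator` is an identity of abelian groups, and all the content moves to
  -- `S*S`.
  S = A - W

  S₀ : S 0 ≈ₚ (1ℤ ∷ [])
  -- `S 0` computes to 1 followed by trailing zeros, which `_≈ₚ_` ignores.
  S₀ zero                = refl
  S₀ (suc zero)          = refl
  S₀ (suc (suc zero))    = refl
  S₀ (suc (suc (suc _))) = refl

  nat2≈ : nat 2 ≈ 2#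
  nat2≈ zero    _ = refl
  nat2≈ (suc _) _ = refl

  nat4≈ : nat 4 ≈ 4#
  nat4≈ zero    _ = refl
  nat4≈ (suc _) _ = refl

  S*S : S * S ≈ nat 1 - nat 4 * x + nat 4 * x ^ 2 - nat 4 * x ^ 3 * y
  S*S = discriminant {x} {y} {B} {C _≢?_ _>?_} {nat 2} {nat 4}
    nat2≈ nat4≈ C≈1+B B-functional-equation

  numerator : W ≈ A - S
  numerator = GroupProperties.x≈z//y 𝕊.+-group W S A (begin
    W + (A - W)  ≈⟨ 𝕊.+-comm W (A - W) ⟩
    A - W + W    ≈⟨ GroupProperties.//-rightDividesˡ 𝕊.+-group W A ⟩
    A            ∎)
    where open SetoidReasoning 𝕊.setoid
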